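{- Let $\mathcal{L}=\langle S, Act_\tau,\to\rangle$ be a finite-branching labelled transition system of processes. Suppose $\phi$ is a formula in $\mathrm{recHML}$ which is must-testable, i.e. there is a test $t$ (a closed term of the test language) such that for every $p\in S$, $p\ \mathbf{must\ satisfy}\ t$ if and only if $p\in[\![\phi]\!]$. Then there exists some $\psi\in\mathrm{mustHML}$ which is logically equivalent to $\phi$, i.e. $[\![\psi]\!]=[\![\phi]\!]$.
   Context: **Labelled transition systems.** An LTS over a countable set $Act$ of external actions is a triple $\langle S,Act_\tau,\to\rangle$ with $S$ a countable set of states (processes), $Act_\tau=Act\cup\{\tau\}$ where $\tau\notin Act$, and $\to\subseteq S\times Act_\tau\times S$; write $s\xrightarrow{\alpha}s'$ for $(s,\alpha,s')\in\to$, and $s\xrightarrow{\alpha}$ if such an $s'$ exists. The letter $a$ ranges over $Act$, $\alpha$ over $Act_\tau$. $\mathrm{Succ}(s)=\{s' : s\xrightarrow{\alpha}s'\text{ for some }\alpha\in Act_\tau\}$; the LTS is finite branching if $\mathrm{Succ}(s)$ is finite for all $s\in S$. $s\Uparrow$ (diverges) if there is an infinite path $s\xrightarrow{\tau}s_1\xrightarrow{\tau}\cdots$; otherwise $s\Downarrow$ (converges). Weak transitions: $\stackrel{\tau}{\Rightarrow}$ is the reflexive transitive closure of $\xrightarrow{\tau}$, and $s\stackrel{a}{\Rightarrow}s'$ means $s\stackrel{\tau}{\Rightarrow}s''\xrightarrow{a}s'''\stackrel{\tau}{\Rightarrow}s'$ for some $s'',s'''$; $s\stackrel{\alpha}{\Rightarrow}$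 means $s\stackrel{\alpha}{\Rightarrow}s'$ for some $s'$. **The languages recHML and mustHML.** $\mathrm{recHML}$ is the set of closed formulae generated by $\phi ::= \mathtt{tt}\mid\mathtt{ff}\mid X\mid \mathrm{Acc}\,A\mid\phi_1\vee\phi_2\mid\phi_1\wedge\phi_2\mid\langle\alpha\rangle\phi\mid[\alpha]\phi\mid\min(X,\phi)\mid\max(X,\phi)$, where $X$ ranges over a countable set $Var$ of variables, $\alpha\in Act_\tau$, $A$ is a finite subset of $Act$, and $\min(X,\cdot)$, $\max(X,\cdot)$ bind $X$. $\mathrm{mustHML}$ is the set of closed formulae generated by the fragment $\phi ::= \mathtt{tt}\mid\mathtt{ff}\mid \mathrm{Acc}\,A\mid X\mid[\alpha]\phi\mid\phi_1\wedge\phi_2\mid \min(X,\phi)$. Given an environment $\rho:Var\to 2^S$: $[\![\mathtt{tt}]\!]\rho=S$; $[\![\mathtt{ff}]\!]\rho=\emptyset$; $[\![X]\!]\rho=\rho(X)$; $[\![\mathrm{Acc}\,A]\!]\rho=\{s : s\Downarrow,\text{ and } s\stackrel{\tau}{\Rightarrow}s'\text{ implies } s'\stackrel{a}{\Rightarrow}\text{ for some }a\in A\}$; $[\![\langle\alpha\rangle\phi]\!]\rho=\{s : s\stackrel{\alpha}{\Rightarrow}s'\text{ for some }s'\in[\![\phi]\!]\rho\}$; $[\![[\alpha]\phi]\!]\rho=\{s : s\Downarrow,\text{ and } s\stackrel{\alpha}{\Rightarrow}s'\text{ implies }s'\in[\![\phi]\!]\rho\}$; $\vee,\wedge$ are union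 and intersection; $[\![\min(X,\phi)]\!]\rho=\bigcap\{P\subseteq S : [\![\phi]\!]\rho[X\mapsto P]\subseteq P\}$; $[\![\max(X,\phi)]\!]\rho=\bigcup\{P\subseteq S : P\subseteq[\![\phi]\!]\rho[X\mapsto P]\}$. For closed $\phi$ the environment is omitted. **Tests.** Let $\omega\notin Act_\tau$. Tests are the closed terms of $t::=0\mid\alpha.t\mid\omega.0\mid X\mid t_1+t_2\mid\mu X.t$ ($\alpha\in Act_\tau$, $\mu X$ binds $X$), with transitions given by the rules: $\alpha.t\xrightarrow{\alpha}t$ for $\alpha\in Act_\tau\cup\{\omega\}$; if $t_i\xrightarrow{\alpha}t'$ for $i=1$ or $i=2$ then $t_1+t_2\xrightarrow{\alpha}t'$; $\mu X.t\xrightarrow{\tau}t\{\mu X.t/X\}$. **Testing.** For a process $p$ and test $t$, the experiment $p\,|\,t$ has only $\tau$-moves: $p|t\to p'|t$ if $p\xrightarrow{\tau}p'$; $p|t\to p|t'$ if $t\xrightarrow{\tau}t'$; $p|t\to p'|t'$ if $p\xrightarrow{a}p'$ and $t\xrightarrow{a}t'$ for some $a\in Act$. A computation of $p|t$ is a maximal (finite or infinite) path $p|t\to p_1|t_1\to\cdots$ (with $p_0=p$, $t_0=t$); it is successful if $t_n\xrightarrow{\omega}$ for some $n\ge0$. $p\ \mathbf{must\ satisfy}\ t$ if every computation of $p|t$ is successful. -}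

module Defs where

open import Data.Empty.Polymorphic using (⊥)
open import Data.Fin using (Fin; zero; suc)
open import Data.List using (List)
import Data.List.Membership.Propositional as List
open import Data.Nat using (ℕ; zero; suc)
open import Data.Product using (Σ-syntax; ∃-syntax; ∃; _×_; _,_)
open import Data.Sum using (_⊎_)
open import Data.Unit.Polymorphic using (⊤)
open import Data.Vec.Functional using (Vector; []; _∷_)
open import Function using (_∘_; _⇔_; _↣_)
open import Level using (0ℓ; Lift) renaming (suc to lsuc)
open import Relation.Binary.Construct.Closure.ReflexiveTransitive using (Star; ε; _◅_)
open import Relation.Binary.PropositionalEquality using (_≡_)
open import Relation.Nullary using (¬_)
open import Relation.Unary using (Pred; _∈_; _⊆_; _∪_; _∩_)

Countable : Set → Set
Countable A = A ↣ ℕ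

data Actτ (Act : Set) : Set where
  τ   : Actτ Act
  act : Act → Actτ Act

record LTS : Set₁ where
  field
    Act             : Set
    State           : Set
    act-countable   : Countable Act
    state-countable : Countable State
    _—[_]→_         : State → Actτ Act → State → Set

-- Well-scoped de Bruijn syntax: the variables of a formula in Formula Act n
-- are Fin n, the innermost binder being zero.  Acc takes a finite set of
-- actions as a list, of which only the members matter.
data Formula (Act : Set) (n : ℕ) : Set where
  tt ff     : Formula Act n
  var       : Fin n → Formula Act n
  Acc       : List Act → Formula Act n
  _∨_ _∧_   : Formula Act n → Formula Act n → Formula Act n
  ⟨_⟩_ ［_］_ : Actτ Act → Formula Act n → Formula Act n
  min max   : Formula Act (suc n) → Formula Act n

RecHML : Set → Set
RecHML Act = Formula Act 0

data IsMustHML {Act : Set} {n : ℕ} : Formula Act n → Set where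
  tt   : IsMustHML tt
  ff   : IsMustHML ff
  Acc  : ∀ A → IsMustHML (Acc A)
  var  : ∀ X → IsMustHML (var X)
  ［_］_ : ∀ α {φ} → IsMustHML φ → IsMustHML (［ α ］ φ)
  _∧_  : ∀ {φ ψ} → IsMustHML φ → IsMustHML ψ → IsMustHML (φ ∧ ψ)
  min  : ∀ {φ} → IsMustHML φ → IsMustHML (min φ)

data Test (Act : Set) (n : ℕ) : Set where
  𝟘    : Test Act n
  _∙_  : Actτ Act → Test Act n → Test Act n
  ω∙𝟘  : Test Act n
  var  : Fin n → Test Act n
  _⊕_  : Test Act n → Test Act n → Test Act n
  μ    : Test Act (suc n) → Test Act n

rename : ∀ {Act m n} → (Fin m → Fin n) → Test Act m → Test Act n
rename r 𝟘         = 𝟘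
rename r (α ∙ t)   = α ∙ rename r t
rename r ω∙𝟘       = ω∙𝟘
rename r (var X)   = var (r X)
rename r (t₁ ⊕ t₂) = rename r t₁ ⊕ rename r t₂
rename r (μ t)     = μ (rename (zero ∷ (suc ∘ r)) t)

substitute : ∀ {Act m n} → Vector (Test Act n) m → Test Act m → Test Act n
substitute σ 𝟘         = 𝟘
substitute σ (α ∙ t)   = α ∙ substitute σ t
substitute σ ω∙𝟘       = ω∙𝟘
substitute σ (var X)   = σ X
substitute σ (t₁ ⊕ t₂) = substitute σ t₁ ⊕ substitute σ t₂
substitute σ (μ t)     = μ (substitute (var zero ∷ (rename suc ∘ σ)) t)

_[_] : ∀ {Act n} → Test Act (suc n) → Test Act n → Test Act n
t [ u ] = substitute (u ∷ var) t

data TestLabel (Act : Set) : Set where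
  ω   : TestLabel Act
  lab : Actτ Act → TestLabel Act

data _—⟨_⟩→_ {Act : Set} : Test Act 0 → TestLabel Act → Test Act 0 → Set where
  prefix : ∀ {α t} → (α ∙ t) —⟨ lab α ⟩→ t
  report : ω∙𝟘 —⟨ ω ⟩→ 𝟘
  sumˡ   : ∀ {t₁ t₂ l t′} → t₁ —⟨ l ⟩→ t′ → (t₁ ⊕ t₂) —⟨ l ⟩→ t′
  sumʳ   : ∀ {t₁ t₂ l t′} → t₂ —⟨ l ⟩→ t′ → (t₁ ⊕ t₂) —⟨ l ⟩→ t′
  unfold : ∀ {t} → μ t —⟨ lab τ ⟩→ (t [ μ t ])

module _ (L : LTS) where
  open LTS L

  Succ : State → Pred State 0ℓ
  Succ s s′ = ∃[ α ] s —[ α ]→ s′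

  FiniteBranching : Set
  FiniteBranching = ∀ s → ∃[ xs ] (∀ s′ → s′ ∈ Succ s ⇔ s′ List.∈ xs)

  _⇑ : State → Set
  s ⇑ = Σ[ path ∈ (ℕ → State) ]
          path 0 ≡ s × (∀ n → path n —[ τ ]→ path (suc n))

  _⇓ : State → Set
  s ⇓ = ¬ (s ⇑)

  _=[_]⇒_ : State → Actτ Act → State → Set
  s =[ τ     ]⇒ s′ = Star (λ x y → x —[ τ ]→ y) s s′
  s =[ act a ]⇒ s′ = ∃[ s″ ] ∃[ s‴ ]
    (s =[ τ ]⇒ s″) × (s″ —[ act a ]→ s‴) × (s‴ =[ τ ]⇒ s′)

  -- The fixed points quantify over all (small) predicates on states, so the
  -- interpretation lives one universe higher than the predicates themselves.

  ⟦_⟧_ : ∀ {n} → Formula Act n → Vector (Pred State 0ℓ) n → Pred State (lsuc 0ℓ)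
  ⟦ tt      ⟧ ρ = λ s → ⊤
  ⟦ ff      ⟧ ρ = λ s → ⊥
  ⟦ var X   ⟧ ρ = λ s → Lift (lsuc 0ℓ) (s ∈ ρ X)
  ⟦ Acc A   ⟧ ρ = λ s → Lift (lsuc 0ℓ)
    (s ⇓ × (∀ s′ → s =[ τ ]⇒ s′ → ∃[ a ] a List.∈ A × ∃ λ s″ → s′ =[ act a ]⇒ s″))
  ⟦ φ ∨ ψ   ⟧ ρ = ⟦ φ ⟧ ρ ∪ ⟦ ψ ⟧ ρ
  ⟦ φ ∧ ψ   ⟧ ρ = ⟦ φ ⟧ ρ ∩ ⟦ ψ ⟧ ρ
  ⟦ ⟨ α ⟩ φ ⟧ ρ = λ s → ∃[ s′ ] (s =[ α ]⇒ s′) × s′ ∈ ⟦ φ ⟧ ρ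
  ⟦ ［ α ］ φ ⟧ ρ = λ s → s ⇓ × (∀ s′ → s =[ α ]⇒ s′ → s′ ∈ ⟦ φ ⟧ ρ)
  ⟦ min φ   ⟧ ρ = λ s → (P : Pred State 0ℓ) → ⟦ φ ⟧ (P ∷ ρ) ⊆ P → s ∈ P
  ⟦ max φ   ⟧ ρ = λ s → Σ[ P ∈ Pred State 0ℓ ] P ⊆ ⟦ φ ⟧ (P ∷ ρ) × s ∈ P

  ⟦_⟧₀ : RecHML Act → Pred State (lsuc 0ℓ)
  ⟦ φ ⟧₀ = ⟦ φ ⟧ []

  data Experiment : Set where
    _∣_ : State → Test Act 0 → Experiment

  data _⟶_ : Experiment → Experiment → Set where
    left  : ∀ {p p′ t} → p —[ τ ]→ p′ → (p ∣ t) ⟶ (p′ ∣ t)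
    right : ∀ {p t t′} → t —⟨ lab τ ⟩→ t′ → (p ∣ t) ⟶ (p ∣ t′)
    sync  : ∀ {p p′ t t′ a} → p —[ act a ]→ p′ → t —⟨ lab (act a) ⟩→ t′ →
            (p ∣ t) ⟶ (p′ ∣ t′)

  data Computation (e : Experiment) : Set where
    finite   : ∀ {e′} → Star _⟶_ e e′ → ¬ (∃[ e″ ] e′ ⟶ e″) → Computation e
    infinite : (path : ℕ → Experiment) → path 0 ≡ e →
               (∀ n → path n ⟶ path (suc n)) → Computation e

  Reports : Experiment → Set
  Reports (p ∣ t) = ∃[ t′ ] t —⟨ ω ⟩→ t′

  ReportsAlong : ∀ {e e′} → Star _⟶_ e e′ → Set
  ReportsAlong {e} ε        = Reports e
  ReportsAlong {e} (_ ◅ es) = Reports e ⊎ ReportsAlong es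

  Successful : ∀ {e} → Computation e → Set
  Successful (finite es _)       = ReportsAlong es
  Successful (infinite path _ _) = ∃[ n ] Reports (path n)

  _must-satisfy_ : State → Test Act 0 → Set
  p must-satisfy t = (c : Computation (p ∣ t)) → Successful c

  MustTestable : RecHML Act → Set₁
  MustTestable φ = ∃[ t ] (∀ p → p must-satisfy t ⇔ p ∈ ⟦ φ ⟧₀)

  LogicallyEquivalent : RecHML Act → RecHML Act → Set₁
  LogicallyEquivalent ψ φ = ∀ p → p ∈ ⟦ ψ ⟧₀ ⇔ p ∈ ⟦ φ ⟧₀

{-# OPTIONS --safe #-}

-- The formula of a test t describes the least fixed point of the clauses
--   p must t  iff  t reports, or p converges, p | t cannot get stuck, and
--   p′ must t′ whenever t —α→ t′ and p ⇒α p′,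
-- which are formulas of mustHML: the part on being stuck is Acc of the initial
-- actions of t if t has no τ-move, and is void otherwise.  A test has finitely
-- many derivatives, so these clauses form a finite system, and Bekić's principle
-- solves it by nested min's.

module Submission where

open import Axiom.ExcludedMiddle using (ExcludedMiddle)
open import Data.Fin using (Fin; zero; suc)
open import Data.List using (List; []; _∷_; _++_; filter; length)
open import Data.List.Membership.Propositional using () renaming (_∈_ to _∈ₗ_)
open import Data.List.Membership.Propositional.Properties
  using (∈-++⁺ˡ; ∈-++⁺ʳ; ∈-++⁻; ∈-filter⁺)
open import Data.List.Properties using (filter-notAll)
open import Data.List.Relation.Unary.Any using (here; there)
import Data.List.Relation.Unary.Any as Any
open import Data.Nat using (ℕ; zero; suc; _<_)
open import Data.Nat.Induction using (<-wellFounded)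
open import Data.Product using (_×_; ∃-syntax; Σ-syntax; _,_; proj₁; proj₂)
open import Data.Sum using (_⊎_; inj₁; inj₂; [_,_]′; map₁)
open import Data.Vec.Functional using (Vector) renaming ([] to []ᵛ; _∷_ to _∷ᵛ_)
open import Function using (_∘_; id; flip; _⇔_; mk⇔; Equivalence)
open import Function.Definitions using (Injective)
open import Function.Properties.Equivalence using () renaming (trans to ⇔-trans)
open import Induction.WellFounded using (acc) renaming (Acc to Accessible)
open import Level using (0ℓ; lift; lower) renaming (suc to lsuc)
open import Relation.Binary using (Rel; DecidableEquality)
open import Relation.Binary.Construct.Closure.ReflexiveTransitive
  using (ε; _◅_; _◅◅_)
open import Relation.Binary.PropositionalEquality
  using (_≡_; _≢_; refl; sym; trans; cong; cong₂; subst)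
open import Relation.Nullary using (¬_; yes; no; contradiction; ¬?)
open import Relation.Nullary.Decidable using (map′; decidable-stable)
open import Relation.Unary using (Pred)
open import Defs

open Equivalence using (to; from)

-- Substitution in tests

module _ {Act : Set} where

  -- Composites enter as any `u` that agrees with them pointwise, since equality of functions would
  -- need extensionality; the pointwise form also passes under a binder.
  rename-rename : ∀ {l m n} {r : Fin l → Fin m} {s : Fin m → Fin n} {u : Fin l → Fin n} →
    (∀ X → s (r X) ≡ u X) → (t : Test Act l) → rename s (rename r t) ≡ rename u t
  rename-rename eq 𝟘         = refl
  rename-rename eq (α ∙ t)   = cong (α ∙_) (rename-rename eq t)
  rename-rename eq ω∙𝟘       = refl
  rename-rename eq (var X)   = cong var (eq X)
  rename-rename eq (t₁ ⊕ t₂) = cong₂ _⊕_ (rename-rename eq t₁) (rename-rename eq t₂)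
  rename-rename eq (μ t)     =
    cong μ (rename-rename (λ { zero → refl ; (suc X) → cong suc (eq X) }) t)

  substitute-rename : ∀ {l m n} {r : Fin l → Fin m}
    {σ : Vector (Test Act n) m} {υ : Vector (Test Act n) l} →
    (∀ X → σ (r X) ≡ υ X) → (t : Test Act l) → substitute σ (rename r t) ≡ substitute υ t
  substitute-rename eq 𝟘         = refl
  substitute-rename eq (α ∙ t)   = cong (α ∙_) (substitute-rename eq t)
  substitute-rename eq ω∙𝟘       = refl
  substitute-rename eq (var X)   = eq X
  substitute-rename eq (t₁ ⊕ t₂) = cong₂ _⊕_ (substitute-rename eq t₁) (substitute-rename eq t₂)
  substitute-rename eq (μ t)     =
    cong μ (substitute-rename (λ { zero → refl ; (suc X) → cong (rename suc) (eq X) }) t)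

  rename-suc-rename : ∀ {m n} (r : Fin m → Fin n) (t : Test Act m) →
    rename (zero ∷ᵛ (suc ∘ r)) (rename suc t) ≡ rename suc (rename r t)
  rename-suc-rename r t =
    trans (rename-rename (λ _ → refl) t) (sym (rename-rename (λ _ → refl) t))

  rename-substitute : ∀ {l m n} {σ : Vector (Test Act m) l} {r : Fin m → Fin n}
    {υ : Vector (Test Act n) l} →
    (∀ X → rename r (σ X) ≡ υ X) → (t : Test Act l) → rename r (substitute σ t) ≡ substitute υ t
  rename-substitute eq 𝟘         = refl
  rename-substitute eq (α ∙ t)   = cong (α ∙_) (rename-substitute eq t)
  rename-substitute eq ω∙𝟘       = refl
  rename-substitute eq (var X)   = eq X
  rename-substitute eq (t₁ ⊕ t₂) = cong₂ _⊕_ (rename-substitute eq t₁) (rename-substitute eq t₂)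
  rename-substitute {σ = σ} {r} eq (μ t) = cong μ (rename-substitute
    (λ { zero    → refl
       ; (suc X) → trans (rename-suc-rename r (σ X)) (cong (rename suc) (eq X)) }) t)

  substitute-substitute : ∀ {l m n} {σ : Vector (Test Act m) l} {υ : Vector (Test Act n) m}
    {χ : Vector (Test Act n) l} →
    (∀ X → substitute υ (σ X) ≡ χ X) → (t : Test Act l) →
    substitute υ (substitute σ t) ≡ substitute χ t
  substitute-substitute eq 𝟘         = refl
  substitute-substitute eq (α ∙ t)   = cong (α ∙_) (substitute-substitute eq t)
  substitute-substitute eq ω∙𝟘       = refl
  substitute-substitute eq (var X)   = eq X
  substitute-substitute eq (t₁ ⊕ t₂) =
    cong₂ _⊕_ (substitute-substitute eq t₁) (substitute-substitute eq t₂)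
  substitute-substitute {σ = σ} {υ} eq (μ t) = cong μ (substitute-substitute
    (λ { zero    → refl
       ; (suc X) → trans
           (trans (substitute-rename (λ _ → refl) (σ X))
                  (sym (rename-substitute (λ _ → refl) (σ X))))
           (cong (rename suc) (eq X)) }) t)

  substitute-var : ∀ {n} {σ : Vector (Test Act n) n} →
    (∀ X → σ X ≡ var X) → (t : Test Act n) → substitute σ t ≡ t
  substitute-var eq 𝟘         = refl
  substitute-var eq (α ∙ t)   = cong (α ∙_) (substitute-var eq t)
  substitute-var eq ω∙𝟘       = refl
  substitute-var eq (var X)   = eq X
  substitute-var eq (t₁ ⊕ t₂) = cong₂ _⊕_ (substitute-var eq t₁) (substitute-var eq t₂)
  substitute-var eq (μ t)     =
    cong μ (substitute-var (λ { zero → refl ; (suc X) → cong (rename suc) (eq X) }) t)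

  -- Needed for `unfold`: a closed instance of `μ t` unfolds to `t` under the extended substitution.
  substitute-∷ : ∀ {m n} (u : Test Act n) (σ : Vector (Test Act n) m) (t : Test Act (suc m)) →
    substitute (var zero ∷ᵛ (rename suc ∘ σ)) t [ u ] ≡ substitute (u ∷ᵛ σ) t
  substitute-∷ u σ = substitute-substitute
    (λ { zero    → refl
       ; (suc X) → trans (substitute-rename (λ _ → refl) (σ X)) (substitute-var (λ _ → refl) (σ X)) })

-- Derivatives and moves of tests

module _ {Act : Set} where

  mutual
    -- An open test is traversed together with a closing substitution. Passing a `μ` only extends
    -- `σ`, so the recursion is structural and the list finite.
    derivatives : ∀ {n} → Test Act n → Vector (Test Act 0) n → List (Test Act 0)
    derivatives t σ = substitute σ t ∷ properDerivatives t σ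

    properDerivatives : ∀ {n} → Test Act n → Vector (Test Act 0) n → List (Test Act 0)
    properDerivatives 𝟘         σ = []
    properDerivatives (α ∙ t)   σ = derivatives t σ
    properDerivatives ω∙𝟘       σ = []
    -- What `σ X` can reach is accounted for where `X` is bound.
    properDerivatives (var X)   σ = []
    properDerivatives (t₁ ⊕ t₂) σ = properDerivatives t₁ σ ++ properDerivatives t₂ σ
    properDerivatives (μ t)     σ = derivatives t (substitute σ (μ t) ∷ᵛ σ)

  move-substitute : ∀ {n} (t : Test Act n) (σ : Vector (Test Act 0) n) {α u} →
    substitute σ t —⟨ lab α ⟩→ u →
    u ∈ₗ properDerivatives t σ ⊎ (∃[ X ] σ X —⟨ lab α ⟩→ u)
  move-substitute (α ∙ t)   σ prefix      = inj₁ (here refl)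
  move-substitute (var X)   σ tr          = inj₂ (X , tr)
  move-substitute (t₁ ⊕ t₂) σ (sumˡ tr)   = map₁ ∈-++⁺ˡ (move-substitute t₁ σ tr)
  move-substitute (t₁ ⊕ t₂) σ (sumʳ tr)   =
    map₁ (∈-++⁺ʳ (properDerivatives t₁ σ)) (move-substitute t₂ σ tr)
  move-substitute (μ t)     σ unfold      = inj₁ (here (substitute-∷ (substitute σ (μ t)) σ t))

  mutual
    -- Closure under moves holds up to the moves of the tests in `σ`, which an unguarded variable
    -- lets through; for the empty `σ` that alternative vanishes.
    derivatives-move : ∀ {n} (t : Test Act n) (σ : Vector (Test Act 0) n) {α u u′} →
      u ∈ₗ derivatives t σ → u —⟨ lab α ⟩→ u′ →
      u′ ∈ₗ properDerivatives t σ ⊎ (∃[ X ] σ X —⟨ lab α ⟩→ u′)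
    derivatives-move t σ (here refl) tr = move-substitute t σ tr
    derivatives-move t σ (there u∈)  tr = properDerivatives-move t σ u∈ tr

    properDerivatives-move : ∀ {n} (t : Test Act n) (σ : Vector (Test Act 0) n) {α u u′} →
      u ∈ₗ properDerivatives t σ → u —⟨ lab α ⟩→ u′ →
      u′ ∈ₗ properDerivatives t σ ⊎ (∃[ X ] σ X —⟨ lab α ⟩→ u′)
    properDerivatives-move (α ∙ t)   σ u∈ tr = map₁ there (derivatives-move t σ u∈ tr)
    properDerivatives-move (t₁ ⊕ t₂) σ u∈ tr with ∈-++⁻ (properDerivatives t₁ σ) u∈
    ... | inj₁ u∈₁ = map₁ ∈-++⁺ˡ (properDerivatives-move t₁ σ u∈₁ tr)
    ... | inj₂ u∈₂ = map₁ (∈-++⁺ʳ (properDerivatives t₁ σ)) (properDerivatives-move t₂ σ u∈₂ tr)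
    properDerivatives-move (μ t)     σ u∈ tr
      with derivatives-move t (substitute σ (μ t) ∷ᵛ σ) u∈ tr
    ... | inj₁ u′∈             = inj₁ (there u′∈)
    -- The bound variable stands for `μ t` itself, whose only move leads back to the head of the
    -- list.
    ... | inj₂ (zero , unfold) = inj₁ (here (substitute-∷ (substitute σ (μ t)) σ t))
    ... | inj₂ (suc X , tr′)   = inj₂ (X , tr′)

  finite-derivatives : (t : Test Act 0) → ∃[ R ] t ∈ₗ R ×
    (∀ {α u u′} → u ∈ₗ R → u —⟨ lab α ⟩→ u′ → u′ ∈ₗ R)
  finite-derivatives t =
    derivatives t []ᵛ ,
    here (sym (substitute-var (λ ()) t)) ,
    λ u∈ tr → [ there , (λ ()) ]′ (derivatives-move t []ᵛ u∈ tr)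

  moves : Test Act 0 → List (Actτ Act × Test Act 0)
  moves 𝟘         = []
  moves (α ∙ t)   = (α , t) ∷ []
  moves ω∙𝟘       = []
  moves (t₁ ⊕ t₂) = moves t₁ ++ moves t₂
  moves (μ t)     = (τ , t [ μ t ]) ∷ []

  ∈-moves⁻ : ∀ t {α t′} → (α , t′) ∈ₗ moves t → t —⟨ lab α ⟩→ t′
  ∈-moves⁻ (α ∙ t)   (here refl) = prefix
  ∈-moves⁻ (t₁ ⊕ t₂) m∈          = [ sumˡ ∘ ∈-moves⁻ t₁ , sumʳ ∘ ∈-moves⁻ t₂ ]′ (∈-++⁻ (moves t₁) m∈)
  ∈-moves⁻ (μ t)     (here refl) = unfold

  ∈-moves⁺ : ∀ {t α t′} → t —⟨ lab α ⟩→ t′ → (α , t′) ∈ₗ moves t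
  ∈-moves⁺ prefix                = here refl
  ∈-moves⁺ (sumˡ tr)             = ∈-++⁺ˡ (∈-moves⁺ tr)
  ∈-moves⁺ {t₁ ⊕ t₂} (sumʳ tr)   = ∈-++⁺ʳ (moves t₁) (∈-moves⁺ tr)
  ∈-moves⁺ unfold                = here refl

  initials : Test Act 0 → List Act
  initials 𝟘           = []
  initials (τ ∙ t)     = []
  initials (act a ∙ t) = a ∷ []
  initials ω∙𝟘         = []
  initials (t₁ ⊕ t₂)   = initials t₁ ++ initials t₂
  initials (μ t)       = []

  ∈-initials⁻ : ∀ t {a} → a ∈ₗ initials t → ∃[ t′ ] t —⟨ lab (act a) ⟩→ t′
  ∈-initials⁻ (act a ∙ t) (here refl) = t , prefix
  ∈-initials⁻ (t₁ ⊕ t₂)   a∈ with ∈-++⁻ (initials t₁) a∈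
  ... | inj₁ a∈₁ = let t′ , tr = ∈-initials⁻ t₁ a∈₁ in t′ , sumˡ tr
  ... | inj₂ a∈₂ = let t′ , tr = ∈-initials⁻ t₂ a∈₂ in t′ , sumʳ tr

  ∈-initials⁺ : ∀ {t a t′} → t —⟨ lab (act a) ⟩→ t′ → a ∈ₗ initials t
  ∈-initials⁺ prefix              = here refl
  ∈-initials⁺ (sumˡ tr)           = ∈-++⁺ˡ (∈-initials⁺ tr)
  ∈-initials⁺ {t₁ ⊕ t₂} (sumʳ tr) = ∈-++⁺ʳ (initials t₁) (∈-initials⁺ tr)

-- Infinite paths and accessibility, classically

prepend : {A : Set} → A → (ℕ → A) → ℕ → A
prepend x f zero    = x
prepend x f (suc n) = f n

module _ (em : ExcludedMiddle (lsuc 0ℓ)) where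

  em₀ : ExcludedMiddle 0ℓ
  em₀ = map′ lower lift em

  ¬∀⇒∃¬ : {A : Set} {P : Pred A 0ℓ} → ¬ (∀ x → P x) → ∃[ x ] ¬ P x
  ¬∀⇒∃¬ ¬∀ = decidable-stable em₀ λ ¬∃ → ¬∀ λ x → decidable-stable em₀ λ ¬p → ¬∃ (x , ¬p)

  -- A non-accessible point has a non-accessible successor. Excluded middle produces it as an actual
  -- pair, so that `extend` is a function and its iteration is an infinite path.
  noInfinitePath⇒acc : {A : Set} (_↝_ : Rel A 0ℓ) (x : A) →
    ¬ (Σ[ path ∈ (ℕ → A) ] path 0 ≡ x × (∀ n → path n ↝ path (suc n))) →
    Accessible (flip _↝_) x
  noInfinitePath⇒acc {A} _↝_ x ¬path = decidable-stable em₀ λ ¬acc →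
    ¬path (proj₁ ∘ path ¬acc , refl , λ n → proj₁ (proj₂ (extend (path ¬acc n))))
    where
    NonAccessible : Set
    NonAccessible = ∃[ y ] ¬ Accessible (flip _↝_) y

    extend : ((y , _) : NonAccessible) → ∃[ z ] (y ↝ z) × ¬ Accessible (flip _↝_) z
    extend (y , ¬acc) =
      let z , ¬step = ¬∀⇒∃¬ {P = λ z → y ↝ z → Accessible (flip _↝_) z}
                        (λ next → ¬acc (acc λ {z} → next z))
      in z , decidable-stable em₀ (λ ¬↝ → ¬step (λ s → contradiction s ¬↝)) ,
         (λ a → ¬step (λ _ → a))

    path : ¬ Accessible (flip _↝_) x → ℕ → NonAccessible
    path ¬acc zero    = x , ¬acc
    path ¬acc (suc n) = let z , _ , ¬acc′ = extend (path ¬acc n) in z , ¬acc′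

  module _ (L : LTS) where
    open LTS L

    infix  4 _⇒⟨_⟩_ _↝_
    infixr 5 _◅⇒_ _◅◅⇒_

    _⇒⟨_⟩_ : State → Actτ Act → State → Set
    _⇒⟨_⟩_ = _=[_]⇒_ L

    _↝_ : Experiment L → Experiment L → Set
    _↝_ = _⟶_ L

    Converges : State → Set
    Converges = _⇓ L

    Reporting : Test Act 0 → Set
    Reporting t = ∃[ t′ ] t —⟨ ω ⟩→ t′

    -- Weak transitions and convergence

    _◅⇒_ : ∀ {p p′ α q} → p —[ τ ]→ p′ → p′ ⇒⟨ α ⟩ q → p ⇒⟨ α ⟩ q
    _◅⇒_ {α = τ}     s w                     = s ◅ w
    _◅⇒_ {α = act a} s (_ , _ , us , a→ , vs) = _ , _ , s ◅ us , a→ , vs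

    _◅◅⇒_ : ∀ {p p′ α q} → p ⇒⟨ τ ⟩ p′ → p′ ⇒⟨ α ⟩ q → p ⇒⟨ α ⟩ q
    ε        ◅◅⇒ w = w
    (s ◅ ss) ◅◅⇒ w = s ◅⇒ (ss ◅◅⇒ w)

    ⇑-prepend : ∀ {p p′} → p —[ τ ]→ p′ → _⇑ L p′ → _⇑ L p
    ⇑-prepend {p} s (path , refl , steps) =
      prepend p path , refl , λ { zero → s ; (suc n) → steps n }

    ⇓-step : ∀ {p p′} → p —[ τ ]→ p′ → Converges p → Converges p′
    ⇓-step s p⇓ = p⇓ ∘ ⇑-prepend s

    ⇓-steps : ∀ {p p′} → p ⇒⟨ τ ⟩ p′ → Converges p → Converges p′
    ⇓-steps ε        = id
    ⇓-steps (s ◅ ss) = ⇓-steps ss ∘ ⇓-step s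

    -- For a process p that converges: p | t can get stuck at no p′ | t with p ⇒τ p′.
    Unstuck : State → Test Act 0 → Set
    Unstuck p t =
      (∃[ t′ ] t —⟨ lab τ ⟩→ t′) ⊎
      (∀ p′ → p ⇒⟨ τ ⟩ p′ →
        ∃[ a ] (∃[ t′ ] t —⟨ lab (act a) ⟩→ t′) × ∃[ p″ ] p′ ⇒⟨ act a ⟩ p″)

    -- The clauses and their least solution

    Clause : (State → Test Act 0 → Set) → State → Test Act 0 → Set
    Clause X p t = Converges p × Unstuck p t ×
      (∀ α t′ → t —⟨ lab α ⟩→ t′ → ∀ p′ → p ⇒⟨ α ⟩ p′ → X p′ t′)

    -- The least solution of the clauses in which the unknowns of the tests Γ are
    -- not solved for, but are given by ρ.
    data Passes {n} (Γ : Vector (Test Act 0) n) (ρ : Vector (Pred State 0ℓ) n)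
                (p : State) (t : Test Act 0) : Set where
      given  : ∀ k → Γ k ≡ t → ρ k p → Passes Γ ρ p t
      report : (∀ k → Γ k ≢ t) → Reporting t → Passes Γ ρ p t
      clause : (∀ k → Γ k ≢ t) → ¬ Reporting t → Clause (Passes Γ ρ) p t → Passes Γ ρ p t

    -- Half of Bekić's principle: if the unknown of `t` is given its own solution, every use of
    -- `given zero` can be replaced by the derivation it stands for.
    passes-∷⁻ : ∀ {n} {Γ : Vector (Test Act 0) n} {ρ : Vector (Pred State 0ℓ) n} {t} →
      ∀ {p u} → Passes (t ∷ᵛ Γ) ((λ q → Passes Γ ρ q t) ∷ᵛ ρ) p u → Passes Γ ρ p u
    passes-∷⁻ (given zero refl h)        = h
    passes-∷⁻ (given (suc k) eq h)       = given k eq h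
    passes-∷⁻ (report u∉ rep)            = report (u∉ ∘ suc) rep
    passes-∷⁻ (clause u∉ ¬r (c , g , x)) =
      clause (u∉ ∘ suc) ¬r (c , g , λ α t′ tr p′ w → passes-∷⁻ (x α t′ tr p′ w))

    module _ {n} {Γ : Vector (Test Act 0) n} {ρ : Vector (Pred State 0ℓ) n}
             {t : Test Act 0} (¬rep : ¬ Reporting t) {P : Pred State 0ℓ}
             (P-closed : ∀ {p} → Clause (Passes (t ∷ᵛ Γ) (P ∷ᵛ ρ)) p t → P p) where

      -- The other half: `t` may be given any `P` closed under its clause. As this closure says
      -- nothing about reports, `t` must not report.
      passes-∷⁺ : ∀ {p u} → Passes Γ ρ p u → Passes (t ∷ᵛ Γ) (P ∷ᵛ ρ) p u
      passes-∷⁺ (given k eq h)  = given (suc k) eq h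
      passes-∷⁺ (report u∉ rep) = report (λ { zero refl → ¬rep rep ; (suc k) → u∉ k }) rep
      passes-∷⁺ {u = u} (clause u∉ ¬r (c , g , x)) with em₀ {P = t ≡ u}
      ... | yes refl = given zero refl
        (P-closed (c , g , λ α t′ tr p′ w → passes-∷⁺ (x α t′ tr p′ w)))
      ... | no t≢u   = clause (λ { zero → t≢u ; (suc k) → u∉ k }) ¬r
        (c , g , λ α t′ tr p′ w → passes-∷⁺ (x α t′ tr p′ w))

      -- With `t` among the unknowns and not in `Γ`, only `given zero` can derive it, so the
      -- translated derivation contains a proof of `P`.
      passes-least : (∀ k → Γ k ≢ t) → ∀ {p} → Passes Γ ρ p t → P p
      passes-least t∉Γ pass with passes-∷⁺ pass
      ... | given zero _ h      = h
      ... | given (suc k) eq _  = contradiction eq (t∉Γ k)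
      ... | report t∉ _         = contradiction refl (t∉ zero)
      ... | clause t∉ _ _       = contradiction refl (t∉ zero)

    -- Translation of tests

    -- The meaning of a formula lives one universe above the predicates that `min` ranges over. `Q`
    -- is small, so a solution can itself be an instance of that quantifier.
    Expresses : ∀ {n} → Formula Act n → (Vector (Pred State 0ℓ) n → Pred State 0ℓ) → Set₁
    Expresses ψ Q = IsMustHML ψ × (∀ ρ p → ⟦_⟧_ L ψ ρ p ⇔ Q ρ p)

    unstuck-formula : ∀ {n} t → ∃[ ψ ] Expresses {n} ψ (λ _ p → Converges p × Unstuck p t)
    unstuck-formula t with em₀ {P = ∃[ t′ ] t —⟨ lab τ ⟩→ t′}
    ... | yes τ-move = ［ τ ］ tt , ［ τ ］ tt , λ ρ p → mk⇔
          (λ (c , _) → c , inj₁ τ-move)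
          (λ (c , _) → c , _)
    ... | no ¬τ-move = Acc (initials t) , Acc (initials t) , λ ρ p → mk⇔
          (λ (lift (c , h)) → c , inj₂ λ p′ w →
            let a , a∈ , p″ = h p′ w in a , ∈-initials⁻ t a∈ , p″)
          (λ { (c , inj₁ τ-move) → contradiction τ-move ¬τ-move
             ; (c , inj₂ h) → lift (c , λ p′ w →
                 let a , (_ , tr) , p″ = h p′ w in a , ∈-initials⁺ tr , p″) })

    -- The conjunction starts from `χ`, whose meaning implies the convergence that each box demands
    -- besides its condition on successors.
    boxes-formula : ∀ {n} (X : Vector (Pred State 0ℓ) n → State → Test Act 0 → Set) →
      (ms : List (Actτ Act × Test Act 0)) →
      (∀ {α t} → (α , t) ∈ₗ ms → ∃[ ψ ] Expresses {n} ψ (λ ρ p → X ρ p t)) →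
      ∀ χ {Q} → Expresses {n} χ Q → (∀ {ρ p} → Q ρ p → Converges p) →
      ∃[ ψ ] Expresses {n} ψ (λ ρ p → Q ρ p ×
        (∀ α t → (α , t) ∈ₗ ms → ∀ p′ → p ⇒⟨ α ⟩ p′ → X ρ p′ t))
    boxes-formula X [] ih χ (χ-must , χ⇔) Q⇒⇓ =
      χ , χ-must , λ ρ p → mk⇔ (λ h → to (χ⇔ ρ p) h , λ _ _ ()) (from (χ⇔ ρ p) ∘ proj₁)
    boxes-formula X ((α , t) ∷ ms) ih χ χ-expr Q⇒⇓ =
      let ψ , ψ-must , ψ⇔ = ih (here refl)
          θ , θ-must , θ⇔ = boxes-formula X ms (ih ∘ there) χ χ-expr Q⇒⇓
      in ((［ α ］ ψ) ∧ θ) , ((［ α ］ ψ-must) ∧ θ-must) , λ ρ p → mk⇔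
        (λ ((_ , h) , hs) →
          let q , rest = to (θ⇔ ρ p) hs
          in q , λ { _ _ (here refl) p′ w → to (ψ⇔ ρ p′) (h p′ w)
                   ; β u (there m∈) → rest β u m∈ })
        (λ (q , h) →
          (Q⇒⇓ q , λ p′ w → from (ψ⇔ ρ p′) (h α t (here refl) p′ w)) ,
          from (θ⇔ ρ p) (q , λ β u m∈ → h β u (there m∈)))

    clause-formula : ∀ {n} (X : Vector (Pred State 0ℓ) n → State → Test Act 0 → Set) t →
      (∀ {α t′} → t —⟨ lab α ⟩→ t′ → ∃[ ψ ] Expresses {n} ψ (λ ρ p → X ρ p t′)) →
      ∃[ ψ ] Expresses {n} ψ (λ ρ p → Clause (X ρ) p t)
    clause-formula X t ih =
      let χ , χ-expr = unstuck-formula t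
          ψ , ψ-must , ψ⇔ = boxes-formula X (moves t) (ih ∘ ∈-moves⁻ t) χ χ-expr proj₁
      in ψ , ψ-must , λ ρ p → mk⇔
        (λ s → let (c , g) , h = to (ψ⇔ ρ p) s in c , g , λ α t′ tr → h α t′ (∈-moves⁺ tr))
        (λ (c , g , h) → from (ψ⇔ ρ p) ((c , g) , λ α t′ m∈ → h α t′ (∈-moves⁻ t m∈)))

    _≟ₜ_ : DecidableEquality (Test Act 0)
    t ≟ₜ u = em₀

    module _ (R : List (Test Act 0))
             (R-closed : ∀ {α u u′} → u ∈ₗ R → u —⟨ lab α ⟩→ u′ → u′ ∈ₗ R) where

      -- The recursion is on U, which contains every test of R that has no variable yet.
      passes-formula : (U : List (Test Act 0)) → Accessible _<_ (length U) →
        ∀ {n} (Γ : Vector (Test Act 0) n) → Injective _≡_ _≡_ Γ →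
        (∀ {t} → t ∈ₗ R → (∀ k → Γ k ≢ t) → t ∈ₗ U) →
        ∀ {t} → t ∈ₗ R → ∃[ ψ ] Expresses ψ (λ ρ p → Passes Γ ρ p t)
      passes-formula U (acc rec) Γ Γ-inj R⊆ {t} t∈R with em₀ {P = ∃[ k ] Γ k ≡ t}
      ... | yes (k , refl) = var k , var k , λ ρ p → mk⇔
            (λ (lift h) → given k refl h)
            (λ { (given j eq h) → lift (subst (λ i → ρ i p) (Γ-inj eq) h)
               ; (report t∉ _)   → contradiction refl (t∉ k)
               ; (clause t∉ _ _) → contradiction refl (t∉ k) })
      ... | no t∉ with em₀ {P = Reporting t}
      ...   | yes rep = tt , tt , λ ρ p → mk⇔ (λ _ → report (λ k eq → t∉ (k , eq)) rep) _
      ...   | no ¬rep =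
        -- `t` becomes the variable `zero` while its moves are translated, so that loops through `t`
        -- are closed by the surrounding `min`.
        let ψ , ψ-must , ψ⇔ = clause-formula (Passes (t ∷ᵛ Γ)) t
              (λ tr → passes-formula U′ (rec U′<U) (t ∷ᵛ Γ) inj′ R⊆′ (R-closed t∈R tr))
        in min ψ , min ψ-must , λ ρ p → mk⇔
          -- The least fixed point is compared with the solution itself, which is closed under the
          -- clause by `passes-∷⁻`; the converse is `passes-least`.
          (λ h → h (λ q → Passes Γ ρ q t) λ {q} s →
            let c , g , x = to (ψ⇔ _ q) s
            in clause t∉Γ ¬rep
                 (c , g , λ α t′ tr p′ w → passes-∷⁻ (x α t′ tr p′ w)))
          (λ pass P ψ⊆P → passes-least ¬rep (λ {q} c → ψ⊆P (from (ψ⇔ (P ∷ᵛ ρ) q) c)) t∉Γ pass)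
        where
        t∉Γ : ∀ k → Γ k ≢ t
        t∉Γ k eq = t∉ (k , eq)

        U′ : List (Test Act 0)
        U′ = filter (λ u → ¬? (t ≟ₜ u)) U

        U′<U : length U′ < length U
        U′<U = filter-notAll (λ u → ¬? (t ≟ₜ u)) U
                 (Any.map (λ t≡u t≢u → t≢u t≡u) (R⊆ t∈R t∉Γ))

        inj′ : Injective _≡_ _≡_ (t ∷ᵛ Γ)
        inj′ {zero}  {zero}  _  = refl
        inj′ {zero}  {suc k} eq = contradiction (sym eq) (t∉Γ k)
        inj′ {suc k} {zero}  eq = contradiction eq (t∉Γ k)
        inj′ {suc j} {suc k} eq = cong suc (Γ-inj eq)

        R⊆′ : ∀ {u} → u ∈ₗ R → (∀ k → (t ∷ᵛ Γ) k ≢ u) → u ∈ₗ U′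
        R⊆′ u∈R u∉ = ∈-filter⁺ (λ u → ¬? (t ≟ₜ u)) (R⊆ u∈R (u∉ ∘ suc)) (u∉ zero)

    test-formula : ∀ t → ∃[ ψ ] Expresses ψ (λ ρ p → Passes []ᵛ ρ p t)
    test-formula t =
      let R , t∈R , R-closed = finite-derivatives t
      in passes-formula R R-closed R (<-wellFounded _) []ᵛ (λ {}) (λ u∈R _ → u∈R) t∈R

    -- Must testing

    -- An inductive form of must testing. `later` asks for a move because a stuck experiment that
    -- does not report ends a failed computation.
    data Must : Experiment L → Set where
      now   : ∀ {e} → Reports L e → Must e
      later : ∀ {e} → ∃[ e′ ] e ↝ e′ → (∀ {e′} → e ↝ e′ → Must e′) → Must e

    Good : Experiment L → Set
    Good e = (c : Computation L e) → Successful L c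

    must⇒good : ∀ {e} → Must e → Good e
    must⇒good (now r)          (finite ε _)                 = r
    must⇒good (now r)          (finite (_ ◅ _) _)           = inj₁ r
    must⇒good (now r)          (infinite path refl _)       = 0 , r
    must⇒good (later move _)   (finite ε stuck)             = contradiction move stuck
    must⇒good (later _ next)   (finite (s ◅ ss) stuck)      = inj₂ (must⇒good (next s) (finite ss stuck))
    must⇒good (later _ next)   (infinite path refl steps)   =
      let n , r = must⇒good (next (steps 0)) (infinite (path ∘ suc) refl (steps ∘ suc))
      in suc n , r

    -- Silent in the sense that success is not reported yet: beyond a report a computation is free
    -- to fail, so only these moves are sure to preserve `Good`.
    SilentMove : Experiment L → Experiment L → Set
    SilentMove e e′ = ¬ Reports L e × e ↝ e′

    good-step : ∀ {e e′} → Good e → SilentMove e e′ → Good e′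
    good-step good (¬r , s) (finite ss stuck) with good (finite (s ◅ ss) stuck)
    ... | inj₁ r = contradiction r ¬r
    ... | inj₂ h = h
    good-step {e} good (¬r , s) (infinite path refl steps)
      with good (infinite (prepend e path) refl λ { zero → s ; (suc n) → steps n })
    ... | zero  , r = contradiction r ¬r
    ... | suc n , r = n , r

    -- An infinite path of silent moves would be a computation that never reports.
    good⇒acc : ∀ {e} → Good e → Accessible (flip SilentMove) e
    good⇒acc {e} good = noInfinitePath⇒acc SilentMove e λ (path , eq , steps) →
      let n , r = good (infinite path eq (proj₂ ∘ steps)) in proj₁ (steps n) r

    good⇒must : ∀ {e} → Accessible (flip SilentMove) e → Good e → Must e
    good⇒must {e} (acc rec) good with em₀ {P = Reports L e}
    ... | yes r = now r
    ... | no ¬r = later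
      (decidable-stable em₀ λ stuck → ¬r (good (finite ε stuck)))
      (λ s → good⇒must (rec (¬r , s)) (good-step good (¬r , s)))

    -- The least solution and must testing

    module _ {ρ : Vector (Pred State 0ℓ) 0} where

      -- Convergence and both conditions on weak derivatives pass from `p` to `p′`, whose weak
      -- derivatives are also weak derivatives of `p`.
      passes-τ : ∀ {p p′ t} → p ⇒⟨ τ ⟩ p′ → Passes []ᵛ ρ p t → Passes []ᵛ ρ p′ t
      passes-τ w (report t∉ rep) = report t∉ rep
      passes-τ w (clause t∉ ¬rep (c , g , x)) = clause t∉ ¬rep
        ( ⇓-steps w c
        , [ inj₁ , (λ h → inj₂ λ q v → h q (w ◅◅ v)) ]′ g
        , λ α t′ tr q v → x α t′ tr q (w ◅◅⇒ v))

      passes-clause : ∀ {p t} → ¬ Reporting t → Passes []ᵛ ρ p t → Clause (Passes []ᵛ ρ) p t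
      passes-clause ¬rep (report _ rep) = contradiction rep ¬rep
      passes-clause ¬rep (clause _ _ c) = c

      -- By induction on `Must`. After a τ-step of `p` the test is still `t`, so the induction
      -- hypothesis gives the clause of `t` there, which covers all weak moves of `p` that begin
      -- with this step.
      must⇒passes : ∀ {p t} → Must (p ∣ t) → Passes []ᵛ ρ p t
      must⇒passes (now rep) = report (λ ()) rep
      must⇒passes {p} {t} (later move next) with em₀ {P = Reporting t}
      ... | yes rep = report (λ ()) rep
      ... | no ¬rep = clause (λ ()) ¬rep (converges , unstuck move , boxes)
        where
        afterτ : ∀ {p′} → p —[ τ ]→ p′ → Clause (Passes []ᵛ ρ) p′ t
        afterτ s = passes-clause ¬rep (must⇒passes (next (left s)))

        converges : Converges p
        converges (path , refl , steps) =
          proj₁ (afterτ (steps 0)) (path ∘ suc , refl , steps ∘ suc)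

        unstuck : ∃[ e′ ] (p ∣ t) ↝ e′ → Unstuck p t
        unstuck move with em₀ {P = ∃[ t′ ] t —⟨ lab τ ⟩→ t′}
        ... | yes τ-move = inj₁ τ-move
        ... | no ¬τ-move = inj₂ λ { _ ε → here-unstuck move ; q (s ◅ w) → after s q w }
          where
          after : ∀ {p′} → p —[ τ ]→ p′ → ∀ q → p′ ⇒⟨ τ ⟩ q →
            ∃[ a ] (∃[ t′ ] t —⟨ lab (act a) ⟩→ t′) × ∃[ p″ ] q ⇒⟨ act a ⟩ p″
          after s q w with proj₁ (proj₂ (afterτ s))
          ... | inj₁ τ-move = contradiction τ-move ¬τ-move
          ... | inj₂ h      = h q w

          here-unstuck : ∃[ e′ ] (p ∣ t) ↝ e′ →
            ∃[ a ] (∃[ t′ ] t —⟨ lab (act a) ⟩→ t′) × ∃[ p″ ] p ⇒⟨ act a ⟩ p″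
          -- The experiment may move by `p` alone; the action is then found after that step.
          here-unstuck (_ , left s)    =
            let a , tr , p″ , w = after s _ ε in a , tr , p″ , s ◅⇒ w
          here-unstuck (_ , right tr)  = contradiction (_ , tr) ¬τ-move
          here-unstuck (_ , sync s tr) = _ , (_ , tr) , _ , _ , _ , ε , s , ε

        boxes : ∀ α t′ → t —⟨ lab α ⟩→ t′ → ∀ p′ → p ⇒⟨ α ⟩ p′ → Passes []ᵛ ρ p′ t′
        boxes τ       t′ tr p′ ε       = must⇒passes (next (right tr))
        boxes τ       t′ tr p′ (s ◅ w) = proj₂ (proj₂ (afterτ s)) τ t′ tr p′ w
        boxes (act a) t′ tr p′ (_ , _ , ε , s , w) =
          -- `sync` stops before the trailing τ-steps; `passes-τ` carries the result across them.
          passes-τ w (must⇒passes (next (sync s tr)))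
        boxes (act a) t′ tr p′ (q , q′ , s ◅ v , s′ , w) =
          proj₂ (proj₂ (afterτ s)) (act a) t′ tr p′ (q , q′ , v , s′ , w)

      first-move : ∀ {p t a q t′} → t —⟨ lab (act a) ⟩→ t′ → p ⇒⟨ act a ⟩ q →
        ∃[ e ] (p ∣ t) ↝ e
      first-move tr (_ , _ , ε , s , _)     = _ , sync s tr
      first-move tr (_ , _ , s ◅ _ , _ , _) = _ , left s

      mutual
        passes⇒must : ∀ {p t} → Passes []ᵛ ρ p t → Must (p ∣ t)
        passes⇒must (report _ rep) = now rep
        passes⇒must {p} (clause _ _ (c , g , x)) =
          passes⇒must-after g x (noInfinitePath⇒acc _—[ τ ]→_ p c) ε

        -- The inner part of a nested induction: it runs over the τ-steps of the process, which end
        -- by convergence, while the outer one runs over the derivation of `Passes`. The clause is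
        -- kept at the start `p`, so that its premises remain subderivations.
        passes⇒must-after : ∀ {p t} → Unstuck p t →
          (∀ α t′ → t —⟨ lab α ⟩→ t′ → ∀ p′ → p ⇒⟨ α ⟩ p′ → Passes []ᵛ ρ p′ t′) →
          ∀ {q} → Accessible (flip _—[ τ ]→_) q → p ⇒⟨ τ ⟩ q → Must (q ∣ t)
        passes⇒must-after {p} {t} g x {q} (acc rec) w = later (move g) λ
          { (left s)    → passes⇒must-after g x (rec s) (w ◅◅ (s ◅ ε))
          ; (right tr)  → passes⇒must (x τ _ tr _ w)
          ; (sync s tr) → passes⇒must (x (act _) _ tr _ (_ , _ , w , s , ε)) }
          where
          move : Unstuck p t → ∃[ e ] (q ∣ t) ↝ e
          move (inj₁ (_ , tr)) = _ , right tr
          move (inj₂ h)        = let _ , (_ , tr) , _ , v = h _ w in first-move tr v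

      passes⇔must-satisfy : ∀ p t → Passes []ᵛ ρ p t ⇔ _must-satisfy_ L p t
      passes⇔must-satisfy p t = mk⇔
        (must⇒good ∘ passes⇒must)
        (λ good → must⇒passes (good⇒must (good⇒acc good) good))

corollary4p19 : ExcludedMiddle (lsuc 0ℓ) → (L : LTS) → FiniteBranching L →
    (φ : RecHML (LTS.Act L)) → MustTestable L φ →
    ∃[ ψ ] (IsMustHML ψ × LogicallyEquivalent L ψ φ)
corollary4p19 em L _ φ (t , must⇔φ) =
  let ψ , ψ-must , ψ⇔ = test-formula em L t
  in ψ , ψ-must , λ p →
    ⇔-trans (ψ⇔ []ᵛ p) (⇔-trans (passes⇔must-satisfy em L p t) (must⇔φ p))
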